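{- Let $q\ge 2$, $n\ge 2$ and $A=\mathbb{Z}_q$. Every transformation $f:A^n\to A^n$ can be computed by a program which only consists of transpositions $(u,v)$ with $u,v\in A^n$ and $v=u+e^i$ for some $1\le i\le n$, and of the assignment $(e^0\to e^1)$. That is, every transformation of $A^n$ is a finite composition (the empty composition being the identity) of such maps, each of which is an instruction.
   Context: A transformation of $A^n$ is a map $f=(f_1,\dots,f_n):A^n\to A^n$; its coordinate function $f_i:A^n\to A$ is trivial if $f_i(x)=x_i$ for all $x$. An instruction is a transformation of $A^n$ with at most one nontrivial coordinate function. A program of length $L$ computing $f$ is a sequence of instructions $g^1,\dots,g^L$ with $f=g^L\circ\cdots\circ g^1$. For $u,v\in A^n$, the transposition $(u,v)$ is the permutation of $A^n$ which maps $u$ to $v$, $v$ to $u$ and fixes every other element; the assignment $(u\to v)$ is the transformation of $A^n$ which maps $u$ to $v$ and fixes every other element. $e^0\in A^n$ is the all-zero tuple and, for $1\le k\le n$, $e^k\in A^n$ is the $k$-th unit tuple ($e^k_i=1$ if $i=k$ and $0$ otherwise). Addition in $A^n$ is componentwise modulo $q$. -}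

module Defs where

open import Data.Fin.Base using (Fin; toℕ)
import Data.Fin.Properties as Fin
open import Data.Bool.Base using (if_then_else_)
open import Data.List.Base using (List; []; _∷_)
open import Data.List.Relation.Unary.All using (All)
open import Data.Nat.Base using (ℕ; suc; _+_; _≤_; NonZero; NonTrivial; nonTrivial⇒nonZero)
open import Data.Nat.DivMod using (_mod_)
import Data.Nat.Properties as ℕ
open import Data.Product.Base using (_×_)
open import Data.Vec.Base using (Vec; lookup; tabulate; zipWith)
open import Data.Vec.Properties using (≡-dec)
open import Function.Base using (id; _∘_)
open import Relation.Binary.Definitions using (DecidableEquality)
open import Relation.Binary.PropositionalEquality.Core using (_≡_; _≗_)
open import Relation.Nullary.Decidable.Core using (does)
open import Relation.Nullary.Negation.Core using (¬_)

-- The alphabet ℤ_q is represented by its residues 0, …, q-1.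
Tuple : ℕ → ℕ → Set
Tuple q n = Vec (Fin q) n

Transformation : ℕ → ℕ → Set
Transformation q n = Tuple q n → Tuple q n

module _ {q n : ℕ} where

  infix 4 _≟_
  _≟_ : DecidableEquality (Tuple q n)
  _≟_ = ≡-dec Fin._≟_

  Trivial : Transformation q n → Fin n → Set
  Trivial f i = ∀ x → lookup (f x) i ≡ lookup x i

  Instruction : Transformation q n → Set
  Instruction g = ∀ i j → ¬ Trivial g i → ¬ Trivial g j → i ≡ j

  -- The head of the list is applied first.
  compose : List (Transformation q n) → Transformation q n
  compose []       = id
  compose (g ∷ gs) = compose gs ∘ g

  infix 4 _Computes_
  _Computes_ : List (Transformation q n) → Transformation q n → Set
  gs Computes f = All Instruction gs × f ≗ compose gs

  transposition : Tuple q n → Tuple q n → Transformation q n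
  transposition u v x =
    if does (x ≟ u) then v else if does (x ≟ v) then u else x

  assignment : Tuple q n → Tuple q n → Transformation q n
  assignment u v x = if does (x ≟ u) then v else x

module _ {q n : ℕ} .{{_ : NonTrivial q}} where

  private instance
    q≢0 : NonZero q
    q≢0 = nonTrivial⇒nonZero q

  infixl 6 _⊕_
  _⊕_ : Tuple q n → Tuple q n → Tuple q n
  _⊕_ = zipWith (λ a b → (toℕ a + toℕ b) mod q)

  -- Coordinates are numbered from 1, so that e 0 is the all-zero tuple and
  -- e k is the k-th unit tuple for 1 ≤ k ≤ n; larger k are never used.
  e : ℕ → Tuple q n
  e k = tabulate λ i → if does (suc (toℕ i) ℕ.≟ k) then 1 mod q else 0 mod q

  -- Maps are identified up to pointwise equality.
  data Generator (g : Transformation q n) : Set where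
    isTransposition : ∀ u v i → 1 ≤ i → i ≤ n → v ≡ u ⊕ e i →
                      g ≗ transposition u v → Generator g
    isAssignment    : g ≗ assignment (e 0) (e 1) → Generator g

{-# OPTIONS --safe #-}
-- The graph on A^n with edges u — u ⊕ e i is connected, so conjugating along
-- paths yields all transpositions, and conjugating (e 0 → e 1) by these yields
-- all assignments.  A transformation f moving x to y then becomes one that
-- fixes x and all fixed points of f by removing a single factor:
--   if f y = y, then f = f' ∘ (x → y), where f' fixes x and agrees with f elsewhere;
--   if f y ≠ y, then f = (x , y) ∘ f', where f' = (x , y) ∘ f.
module Submission where

open import Defs
open import Data.Fin.Base using (Fin; zero; suc; toℕ; inject₁)
import Data.Fin.Properties as Fin
open import Data.Fin.Induction using (<-weakInduction)
open import Data.Bool.Base using (if_then_else_)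
open import Data.List.Base using (List; []; _∷_; _++_; allFin; cartesianProductWith)
open import Data.List.Membership.Propositional using (_∈_)
open import Data.List.Membership.Propositional.Properties using (∈-allFin; ∈-cartesianProductWith⁺)
open import Data.List.Relation.Unary.All using (All; []; _∷_)
import Data.List.Relation.Unary.All as All
import Data.List.Relation.Unary.All.Properties as All
open import Data.List.Relation.Unary.Any using (here; there)
open import Data.Nat.Base using (ℕ; zero; suc; _+_; NonTrivial; z≤n; s≤s)
open import Data.Nat.DivMod using (_mod_; m%n<n; m<n⇒m%n≡m)
import Data.Nat.Properties as ℕ
open import Data.Product.Base using (∃-syntax; _×_; _,_)
open import Data.Sum.Base using (_⊎_; inj₁; inj₂)
open import Data.Vec.Base using (Vec; []; _∷_; lookup; _[_]≔_)
open import Data.Vec.Properties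
  using (lookup-zipWith; lookup∘tabulate; lookup∘update; lookup∘update′; []≔-lookup)
open import Data.Vec.Relation.Binary.Pointwise.Extensional using (ext; Pointwise-≡⇒≡)
open import Function.Base using (id; _∘_)
open import Relation.Binary.Definitions using (Reflexive; Symmetric; Transitive)
open import Relation.Binary.PropositionalEquality
open import Relation.Nullary.Decidable using (yes; no; does; dec-true; dec-false)
open import Relation.Nullary.Negation.Core using (¬_; contradiction)

-- Changing tuples one coordinate at a time, and listing all tuples.

lookup-injective : ∀ {A : Set} {n} {u v : Vec A n} → lookup u ≗ lookup v → u ≡ v
lookup-injective eq = Pointwise-≡⇒≡ (ext eq)

-- The entries of `u` are replaced by those of `v` from first to last; the recursion runs in the
-- tuples whose head is already `y`.
update-connects : ∀ {A : Set} n {R : Vec A n → Vec A n → Set} →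
                  Reflexive R → Transitive R →
                  (∀ u i a → R u (u [ i ]≔ a)) → ∀ u v → R u v
update-connects zero    rfl tr upd []       []       = rfl
update-connects (suc n) {R} rfl tr upd (x ∷ xs) (y ∷ ys) =
  tr (upd (x ∷ xs) zero y)
     (update-connects n {λ us vs → R (y ∷ us) (y ∷ vs)} rfl tr
       (λ us i → upd (y ∷ us) (suc i)) xs ys)

allTuples : ∀ q n → List (Tuple q n)
allTuples q zero    = [] ∷ []
allTuples q (suc n) = cartesianProductWith _∷_ (allFin q) (allTuples q n)

∈-allTuples : ∀ {q n} (x : Tuple q n) → x ∈ allTuples q n
∈-allTuples []       = here refl
∈-allTuples (a ∷ xs) = ∈-cartesianProductWith⁺ _∷_ (∈-allFin a) (∈-allTuples xs)

-- Transpositions and assignments as maps, and their conjugates.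

module _ {q n : ℕ} where

  private variable
    u v x a : Tuple q n

  transposition-left : ∀ u v → transposition {q} {n} u v u ≡ v
  transposition-left u v rewrite dec-true (u ≟ u) refl = refl

  transposition-right : ∀ u v → transposition {q} {n} u v v ≡ u
  transposition-right u v with v ≟ u
  ... | yes v≡u = v≡u
  ... | no  _ rewrite dec-true (v ≟ v) refl = refl

  transposition-fixes : x ≢ u → x ≢ v → transposition u v x ≡ x
  transposition-fixes {x} {u} {v} x≢u x≢v
    rewrite dec-false (x ≟ u) x≢u | dec-false (x ≟ v) x≢v = refl

  assignment-left : ∀ u v → assignment {q} {n} u v u ≡ v
  assignment-left u v rewrite dec-true (u ≟ u) refl = refl

  assignment-fixes : x ≢ u → assignment u v x ≡ x
  assignment-fixes {x} {u} x≢u rewrite dec-false (x ≟ u) x≢u = refl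

  transposition-involutive : ∀ u v x → transposition {q} {n} u v (transposition u v x) ≡ x
  transposition-involutive u v x with x ≟ u | x ≟ v
  ... | yes refl | _        = transposition-right u v
  ... | no _     | yes refl = transposition-left u v
  ... | no x≢u   | no x≢v   = transposition-fixes x≢u x≢v

  transposition-refl : ∀ u → transposition {q} {n} u u ≗ id
  transposition-refl u x with x ≟ u
  ... | yes x≡u = sym x≡u
  ... | no _    = refl

  transposition-sym : ∀ u v → transposition {q} {n} u v ≗ transposition v u
  transposition-sym u v x with x ≟ u | x ≟ v
  ... | yes refl | yes refl = refl
  ... | yes _    | no _     = refl
  ... | no _     | yes _    = refl
  ... | no _     | no _     = refl

  module _ (s : Transformation q n) (s-involutive : ∀ x → s (s x) ≡ x) where

    private
      shift : s x ≡ a → x ≡ s a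
      shift {x} refl = sym (s-involutive x)

      unshift : x ≡ s a → s x ≡ a
      unshift refl = s-involutive _

    -- As `s` is its own inverse, `s x ≡ a` holds exactly when `x ≡ s a`, so conjugation by `s` only
    -- renames the two points.
    transposition-conjugate : ∀ a b → s ∘ transposition a b ∘ s ≗ transposition (s a) (s b)
    transposition-conjugate a b x with s x ≟ a | s x ≟ b
    ... | yes p | _     = sym (trans (cong (transposition (s a) (s b)) (shift p))
                                     (transposition-left (s a) (s b)))
    ... | no _  | yes p = sym (trans (cong (transposition (s a) (s b)) (shift p))
                                     (transposition-right (s a) (s b)))
    ... | no ¬p | no ¬r = trans (s-involutive x)
                                (sym (transposition-fixes (¬p ∘ unshift) (¬r ∘ unshift)))

    assignment-conjugate : ∀ a b → s ∘ assignment a b ∘ s ≗ assignment (s a) (s b)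
    assignment-conjugate a b x with s x ≟ a
    ... | yes p = sym (trans (cong (assignment (s a) (s b)) (shift p))
                             (assignment-left (s a) (s b)))
    ... | no ¬p = trans (s-involutive x) (sym (assignment-fixes (¬p ∘ unshift)))

  -- Composition, and a criterion for being an instruction.

  compose-++ : ∀ gs hs → compose {q} {n} (gs ++ hs) ≗ compose hs ∘ compose gs
  compose-++ []       hs x = refl
  compose-++ (g ∷ gs) hs x = compose-++ gs hs (g x)

  -- The number `k` counts coordinates from 1, like the index of `e`; hence the `suc` in front of
  -- `toℕ j`.
  AgreeOff : ℕ → Tuple q n → Tuple q n → Set
  AgreeOff k u v = ∀ j → suc (toℕ j) ≢ k → lookup u j ≡ lookup v j

  trivial-off⇒instruction : ∀ {g h : Transformation q n} k → g ≗ h →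
                            (∀ x → AgreeOff k (h x) x) → Instruction g
  trivial-off⇒instruction {g} k g≗h off i j ¬ti ¬tj =
    Fin.toℕ-injective (ℕ.suc-injective (trans (only i ¬ti) (sym (only j ¬tj))))
    where
    only : ∀ i → ¬ Trivial g i → suc (toℕ i) ≡ k
    only i ¬t with suc (toℕ i) ℕ.≟ k
    ... | yes p = p
    ... | no ¬p = contradiction (λ x → trans (cong (λ y → lookup y i) (g≗h x)) (off x i ¬p)) ¬t

  transposition-off : ∀ u v {k} → AgreeOff k u v → ∀ x → AgreeOff k (transposition u v x) x
  transposition-off u v off x j j≢k with x ≟ u | x ≟ v
  ... | yes refl | _        = sym (off j j≢k)
  ... | no _     | yes refl = off j j≢k
  ... | no _     | no _     = refl

  assignment-off : ∀ u v {k} → AgreeOff k u v → ∀ x → AgreeOff k (assignment u v x) x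
  assignment-off u v off x j j≢k with x ≟ u
  ... | yes refl = sym (off j j≢k)
  ... | no _     = refl

-- Adding unit tuples modulo `q`.

mod-toℕ : ∀ {q} (a : Fin (suc q)) m → m ≡ toℕ a → m mod suc q ≡ a
mod-toℕ {q} a _ refl = Fin.toℕ-injective
  (trans (Fin.toℕ-fromℕ< (m%n<n (toℕ a) (suc q))) (m<n⇒m%n≡m (Fin.toℕ<n a)))

module _ {r n : ℕ} where

  private
    -- With two visible successors, `1 mod q` and `0 mod q` compute to `suc zero` and `zero`.
    q : ℕ
    q = suc (suc r)

  lookup-e-self : ∀ (i : Fin n) → lookup (e {q} (suc (toℕ i))) i ≡ suc zero
  lookup-e-self i = trans (lookup∘tabulate _ i)
    (cong (λ b → if b then suc zero else zero) (dec-true (suc (toℕ i) ℕ.≟ suc (toℕ i)) refl))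

  lookup-e-other : ∀ k (i : Fin n) → suc (toℕ i) ≢ k → lookup (e {q} k) i ≡ zero
  lookup-e-other k i i≢k = trans (lookup∘tabulate _ i)
    (cong (λ b → if b then suc zero else zero) (dec-false (suc (toℕ i) ℕ.≟ k) i≢k))

  ⊕-off : ∀ (u : Tuple q n) k → AgreeOff k u (u ⊕ e k)
  ⊕-off u k j j≢k = sym (trans (lookup-zipWith _ j u (e k))
    (mod-toℕ (lookup u j) _
      (trans (cong (λ a → toℕ (lookup u j) + toℕ a) (lookup-e-other k j j≢k))
             (ℕ.+-identityʳ _))))

  -- The value of `inject₁ a` is at most `q` minus 2, so adding 1 does not wrap around.
  update-suc : ∀ (u : Tuple q n) i (a : Fin (suc r)) →
               u [ i ]≔ suc a ≡ (u [ i ]≔ inject₁ a) ⊕ e (suc (toℕ i))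
  update-suc u i a = lookup-injective eq
    where
    u′ : Tuple q n
    u′ = u [ i ]≔ inject₁ a

    eq : lookup (u [ i ]≔ suc a) ≗ lookup (u′ ⊕ e (suc (toℕ i)))
    eq j with j Fin.≟ i
    ... | yes refl = trans (lookup∘update i u (suc a)) (sym
      (trans (lookup-zipWith _ i u′ (e (suc (toℕ i))))
        (mod-toℕ (suc a) _
          (trans (cong₂ (λ b c → toℕ b + toℕ c) (lookup∘update i u (inject₁ a)) (lookup-e-self i))
          (trans (ℕ.+-comm _ 1) (cong suc (Fin.toℕ-inject₁ a)))))))
    ... | no j≢i = trans (lookup∘update′ j≢i u (suc a))
      (trans (sym (lookup∘update′ j≢i u (inject₁ a)))
             (⊕-off u′ (suc (toℕ i)) j (j≢i ∘ Fin.toℕ-injective ∘ ℕ.suc-injective)))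

  generator⇒instruction : ∀ {g : Transformation q n} → Generator g → Instruction g
  generator⇒instruction (isTransposition u v k _ _ refl g≗) =
    trivial-off⇒instruction k g≗ (transposition-off u (u ⊕ e k) (⊕-off u k))
  generator⇒instruction (isAssignment g≗) =
    trivial-off⇒instruction 1 g≗ (assignment-off (e 0) (e 1) e₀-e₁)
    where
    e₀-e₁ : AgreeOff 1 (e 0) (e 1)
    e₀-e₁ j j≢1 = trans (lookup-e-other 0 j λ ()) (sym (lookup-e-other 1 j j≢1))

  -- The monoid spanned by the generators.

  Generated : Transformation q n → Set
  Generated f = ∃[ gs ] (f ≗ compose gs × All Generator gs)

  private variable
    f g : Transformation q n

  generated-resp-≗ : f ≗ g → Generated g → Generated f
  generated-resp-≗ f≗g (gs , g≗ , all) = gs , (λ x → trans (f≗g x) (g≗ x)) , all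

  generated-id : Generated id
  generated-id = [] , (λ _ → refl) , []

  generated-∘ : Generated f → Generated g → Generated (f ∘ g)
  generated-∘ {g = g} (fs , f≗ , allf) (gs , g≗ , allg) =
    -- The program of `g` comes first, since the head of a list is applied first.
    gs ++ fs ,
    (λ x → trans (f≗ (g x)) (trans (cong (compose fs) (g≗ x)) (sym (compose-++ gs fs x)))) ,
    All.++⁺ allg allf

  generator⇒generated : Generator g → Generated g
  generator⇒generated {g} gen = g ∷ [] , (λ _ → refl) , gen ∷ []

  -- Generating all transpositions.

  Swappable : Tuple q n → Tuple q n → Set
  Swappable u v = Generated (transposition u v)

  swappable-refl : Reflexive Swappable
  swappable-refl {u} = generated-resp-≗ (transposition-refl u) generated-id

  swappable-sym : Symmetric Swappable
  swappable-sym {u} {v} = generated-resp-≗ (transposition-sym v u)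

  -- Conjugating `(v w)` by `(u v)` gives `(u w)` when `w` differs from `u` and `v`; the
  -- coincidences are split off first.
  swappable-trans : Transitive Swappable
  swappable-trans {u} {v} {w} uv vw with u ≟ w | v ≟ w
  ... | yes refl | _        = swappable-refl
  ... | no _     | yes refl = uv
  ... | no u≢w   | no v≢w   = generated-resp-≗ conj (generated-∘ uv (generated-∘ vw uv))
    where
    s : Transformation q n
    s = transposition u v

    conj : transposition u w ≗ s ∘ transposition v w ∘ s
    conj x = sym (trans (transposition-conjugate s (transposition-involutive u v) v w x)
      (cong₂ (λ a b → transposition a b x)
        (transposition-right u v)
        (transposition-fixes (u≢w ∘ sym) (v≢w ∘ sym))))

  -- Coordinate `i` climbs from 0 to `a` in steps of one, each step being a transposition among the
  -- generators.
  swappable-update-zero : ∀ u i a → Swappable (u [ i ]≔ zero) (u [ i ]≔ a)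
  swappable-update-zero u i = <-weakInduction (λ a → Swappable (u [ i ]≔ zero) (u [ i ]≔ a))
    swappable-refl
    (λ a 0~a → swappable-trans 0~a (generator⇒generated
      (isTransposition (u [ i ]≔ inject₁ a) (u [ i ]≔ suc a) (suc (toℕ i))
        (s≤s z≤n) (Fin.toℕ<n i) (update-suc u i a) (λ _ → refl))))

  -- The path passes through the tuple whose coordinate `i` is 0: down from `u`, then up to the
  -- value `a`.
  swappable-update : ∀ u i a → Swappable u (u [ i ]≔ a)
  swappable-update u i a = swappable-trans
    (swappable-sym (subst (Swappable (u [ i ]≔ zero)) ([]≔-lookup u i)
                          (swappable-update-zero u i (lookup u i))))
    (swappable-update-zero u i a)

  generated-transposition : ∀ u v → Generated (transposition u v)
  generated-transposition =
    update-connects n {Swappable} swappable-refl swappable-trans swappable-update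

  -- Generating all assignments.

  generated-assignment-conjugate :
    ∀ u v a b → Generated (assignment a b) →
    Generated (assignment (transposition u v a) (transposition u v b))
  generated-assignment-conjugate u v a b gab = generated-resp-≗
    (λ x → sym (assignment-conjugate (transposition u v) (transposition-involutive u v) a b x))
    (generated-∘ (generated-transposition u v) (generated-∘ gab (generated-transposition u v)))

  -- Conjugation by `(v w)` keeps the source `u`, which differs from both points, and carries the
  -- target `v` to `w`.
  generated-assignment-target : ∀ {u v w} → u ≢ v → u ≢ w →
                                Generated (assignment u v) → Generated (assignment u w)
  generated-assignment-target {u} {v} {w} u≢v u≢w guv =
    subst₂ (λ a b → Generated (assignment a b))
      (transposition-fixes u≢v u≢w) (transposition-left v w)
      (generated-assignment-conjugate v w u v guv)

  -- Conjugation by `(a u)` moves the source to `u` and the target to `s b`; the target is then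
  -- corrected to `v`.
  generated-assignment-any : ∀ {a b} → a ≢ b → Generated (assignment a b) →
                             ∀ {u v} → u ≢ v → Generated (assignment u v)
  generated-assignment-any {a} {b} a≢b gab {u} {v} u≢v =
    generated-assignment-target u≢sb u≢v
      (subst (λ c → Generated (assignment c (s b))) (transposition-left a u)
        (generated-assignment-conjugate a u a b gab))
    where
    s : Transformation q n
    s = transposition a u

    -- Since `s` is injective and sends `a` to `u`, equality would force `a ≡ b`.
    u≢sb : u ≢ s b
    u≢sb u≡sb = a≢b (trans (sym (transposition-right a u))
      (trans (cong s u≡sb) (transposition-involutive a u b)))

  -- Factoring arbitrary transformations.

  module _ (gen-assign : ∀ {u v} → u ≢ v → Generated (assignment u v)) where

    -- Induction on a list containing every moved point; it may also contain fixed points, and a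
    -- head that is fixed is simply dropped.
    generated-moving-only : ∀ xs f → (∀ z → f z ≡ z ⊎ z ∈ xs) → Generated f
    generated-moving-only [] f moves = generated-resp-≗ fixed generated-id
      where
      fixed : f ≗ id
      fixed z with inj₁ p ← moves z = p
    generated-moving-only (x ∷ xs) f moves with f x ≟ x
    ... | yes fx≡x = generated-moving-only xs f moves′
      where
      moves′ : ∀ z → f z ≡ z ⊎ z ∈ xs
      moves′ z with moves z
      ... | inj₁ p           = inj₁ p
      ... | inj₂ (here refl) = inj₁ fx≡x
      ... | inj₂ (there z∈)  = inj₂ z∈
    ... | no fx≢x with f (f x) ≟ f x
    -- The assignment acts first and sends `x` to `f x`, where `f′` agrees with `f` and so stays
    -- put.
    ...   | yes ffx≡fx = generated-resp-≗ factor
              (generated-∘ (generated-moving-only xs f′ moves′) (gen-assign (fx≢x ∘ sym)))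
      where
      f′ : Transformation q n
      f′ z = if does (z ≟ x) then x else f z

      f′-other : ∀ {z} → z ≢ x → f′ z ≡ f z
      f′-other {z} z≢x = cong (λ b → if b then x else f z) (dec-false (z ≟ x) z≢x)

      factor : f ≗ f′ ∘ assignment x (f x)
      factor z with z ≟ x
      ... | yes refl = sym (trans (f′-other fx≢x) ffx≡fx)
      ... | no z≢x   = sym (f′-other z≢x)

      moves′ : ∀ z → f′ z ≡ z ⊎ z ∈ xs
      moves′ z with z ≟ x | moves z
      ... | yes z≡x | _               = inj₁ (sym z≡x)
      ... | no _    | inj₁ p          = inj₁ p
      ... | no z≢x  | inj₂ (here z≡x) = contradiction z≡x z≢x
      ... | no _    | inj₂ (there z∈) = inj₂ z∈
    -- The map `s ∘ f` returns `x` to itself, and applying `s` once more recovers `f`.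
    ...   | no ffx≢fx = generated-resp-≗
              (λ z → sym (transposition-involutive x (f x) (f z)))
              (generated-∘ (generated-transposition x (f x))
                           (generated-moving-only xs (s ∘ f) moves′))
      where
      s : Transformation q n
      s = transposition x (f x)

      moves′ : ∀ z → s (f z) ≡ z ⊎ z ∈ xs
      moves′ z with moves z
      -- Neither `x` nor `f x` is fixed by `f`, so a fixed point `z` differs from both and `s`
      -- leaves it in place.
      ... | inj₁ fz≡z = inj₁ (trans (cong s fz≡z) (transposition-fixes
              (λ { refl → fx≢x fz≡z }) (λ { refl → ffx≢fx fz≡z })))
      ... | inj₂ (here refl) = inj₁ (transposition-right x (f x))
      ... | inj₂ (there z∈)  = inj₂ z∈

theorem1 : (q n : ℕ) .{{_ : NonTrivial q}} .{{_ : NonTrivial n}} →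
    (f : Transformation q n) →
    ∃[ gs ] (gs Computes f × All Generator gs)
theorem1 (suc (suc r)) (suc n) f =
  -- Starting from the list of all tuples, the condition on moved points holds for every `f`.
  let gs , f≗ , all = generated-moving-only gen-assign (allTuples _ _) f (inj₂ ∘ ∈-allTuples)
  in  gs , (All.map generator⇒instruction all , f≗) , all
  where
  gen-assign : ∀ {u v} → u ≢ v → Generated (assignment u v)
  -- The first entries of `e 0` and `e 1` compute to `zero` and `suc zero`, so the absurd pattern
  -- separates them.
  gen-assign = generated-assignment-any {a = e 0} {b = e 1} (λ ())
    (generator⇒generated (isAssignment λ _ → refl))
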